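{- Let $X$ be a finite set. For any $\ast\in\mathcal{M}(X)$, the principal right ideal generated by $\ast$ is $$\ast\mathcal{M}(X)=\{\diamond\in\mathcal{M}(X):\pi_\diamond\supseteq\pi_\ast\}.$$
   Context: $\mathcal{M}(X)=X^{X\times X}$ is the set of all binary operations on $X$, a monoid under $\triangleright$ defined by $a(\circ\triangleright\ast)b=(a\circ b)\ast(b\circ a)$ for all $a,b\in X$, with identity $a\circ_{lz}b=a$. The principal right ideal generated by $\ast$ is $\ast\mathcal{M}(X)=\{\ast\triangleright\circ:\circ\in\mathcal{M}(X)\}$. For $\ast\in\mathcal{M}(X)$ let $T_\ast:X\times X\to X\times X$, $T_\ast(a,b)=(a\ast b,b\ast a)$, and let $\pi_\ast$ be the equivalence relation on $X\times X$ defined by $(a,b)\,\pi_\ast\,(u,v)\iff T_\ast(a,b)=T_\ast(u,v)$. Inclusion of relations is as subsets of $(X\times X)\times(X\times X)$. -}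

module Defs where

open import Algebra.Bundles using (Monoid)
open import Algebra.Core using (Op₂)
open import Data.Fin.Base using (Fin)
open import Data.Product.Base using (_×_; _,_; ∃-syntax)
open import Function.Bundles using (_↔_)
open import Level using (Level; _⊔_)
open import Relation.Binary.Core using (Rel)
open import Relation.Binary.PropositionalEquality
  using (_≡_; refl; sym; trans; cong₂)
open import Relation.Unary using (Pred)

private
  variable
    c x ℓ : Level
    X : Set x

Finite : Set x → Set x
Finite X = ∃[ n ] (X ↔ Fin n)

infixl 7 _▷_

_▷_ : Op₂ X → Op₂ X → Op₂ X
(_∘_ ▷ _∗_) a b = (a ∘ b) ∗ (b ∘ a)

lz : Op₂ X
lz a b = a

-- Without function extensionality, two operations are identified when
-- they agree at every pair of arguments.
infix 4 _≈_

_≈_ : Rel (Op₂ {x} X) x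
_∘_ ≈ _∗_ = ∀ a b → a ∘ b ≡ a ∗ b

𝓜 : Set x → Monoid x x
𝓜 X = record
  { Carrier  = Op₂ X
  ; _≈_      = _≈_
  ; _∙_      = _▷_
  ; ε        = lz
  ; isMonoid = record
    { isSemigroup = record
      { isMagma = record
        { isEquivalence = record
          { refl  = λ _ _ → refl
          ; sym   = λ p a b → sym (p a b)
          ; trans = λ p q a b → trans (p a b) (q a b)
          }
        ; ∙-cong = λ {_} {_∘′_} {_∗_} p q a b →
            trans (cong₂ _∗_ (p a b) (p b a)) (q (a ∘′ b) (b ∘′ a))
        }
      ; assoc = λ _ _ _ _ _ → refl
      }
    ; identity = (λ _ _ _ → refl) , (λ _ _ _ → refl)
    }
  }

principalRightIdeal : (M : Monoid c ℓ) → Monoid.Carrier M → Pred (Monoid.Carrier M) (c ⊔ ℓ)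
principalRightIdeal M m n = ∃[ k ] n M.≈ m M.∙ k
  where module M = Monoid M

T : Op₂ X → X × X → X × X
T _∗_ (a , b) = a ∗ b , b ∗ a

π : Op₂ {x} X → Rel (X × X) x
π _∗_ p q = T _∗_ p ≡ T _∗_ q

{-# OPTIONS --safe #-}
module Submission where

-- If π ∗ ⊆ π ◇, then T ∗ (a , b) determines a ◇ b, so ◇ factors through T ∗ by
-- a map defined on the image of T ∗. Finiteness makes membership in this image
-- decidable, and off the image the map may be extended arbitrarily.

open import Defs
open import Algebra.Core using (Op₂)
open import Data.Fin.Properties using (any?) renaming (_≟_ to _≟ᶠ_)
open import Data.Product.Base using (_,_; ∃; ∃-syntax; proj₁)
open import Data.Product.Properties using (≡-dec)
open import Function.Base using (_∘_)
open import Function.Bundles using (module Inverse)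
open import Function.Properties.Inverse using (↔⇒↣)
open import Level using (Level)
open import Relation.Binary.Core using (_⇒_)
open import Relation.Binary.Definitions using (DecidableEquality)
open import Relation.Binary.PropositionalEquality
  using (_≡_; refl; sym; trans; cong; cong₂; subst)
open import Relation.Nullary.Decidable using (Dec; yes; no; map′; via-injection)
open import Relation.Nullary.Negation using (contradiction)
open import Relation.Unary using (Pred; Decidable; _≐_; _∈_)

private
  variable
    x p : Level
    X : Set x

finite⇒≟ : Finite X → DecidableEquality X
finite⇒≟ (_ , X↔Fin) = via-injection (↔⇒↣ X↔Fin) _≟ᶠ_

finite⇒any? : Finite X → {P : Pred X p} → Decidable P → Dec (∃ P)
finite⇒any? (_ , X↔Fin) {P} P? = map′
  (λ (i , pi) → from i , pi)
  (λ (a , pa) → to a , subst P (sym (strictlyInverseʳ a)) pa)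
  (any? (P? ∘ from))
  where open Inverse X↔Fin

-- A positive answer carries an explicit preimage, from which the right factor `k` is computed
-- below.
T-image? : Finite X → (_∗_ : Op₂ X) → Decidable (λ q → ∃[ a ] ∃[ b ] T _∗_ (a , b) ≡ q)
T-image? fin _∗_ q =
  finite⇒any? fin λ a → finite⇒any? fin λ b →
    ≡-dec (finite⇒≟ fin) (finite⇒≟ fin) (T _∗_ (a , b)) q

-- By definition `T (_∗_ ▷ k)` is `T k` after `T _∗_`, so applying `T k` preserves any equality of
-- values of `T _∗_`.
ideal⇒π : (_∗_ _◇_ : Op₂ X) → _◇_ ∈ principalRightIdeal (𝓜 X) _∗_ → π _∗_ ⇒ π _◇_
ideal⇒π _∗_ _◇_ (k , ◇≈∗▷k) {a , b} {u , v} eq =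
  trans (cong₂ _,_ (◇≈∗▷k a b) (◇≈∗▷k b a))
    (trans (cong (T k) eq)
      (sym (cong₂ _,_ (◇≈∗▷k u v) (◇≈∗▷k v u))))

π⇒ideal : Finite X → (_∗_ _◇_ : Op₂ X) → π _∗_ ⇒ π _◇_ →
          _◇_ ∈ principalRightIdeal (𝓜 X) _∗_
π⇒ideal {X = X} fin _∗_ _◇_ π⇒π = k , ◇≈∗▷k
  where
  k : Op₂ X
  k u v with T-image? fin _∗_ (u , v)
  ... | yes (a , b , _) = a ◇ b
  -- Any value would do here; `u` is at hand, so no separate case for empty `X` arises.
  ... | no _            = u

  ◇≈∗▷k : _◇_ ≈ _∗_ ▷ k
  -- Repeating the search made by `k` lets `k (a ∗ b) (b ∗ a)` reduce in each branch.
  ◇≈∗▷k a b with T-image? fin _∗_ (T _∗_ (a , b))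
  -- The preimage found may differ from `(a , b)`, but the two are related by `π _∗_`, hence by
  -- `π _◇_`, whose first components give the claim.
  ... | yes (_ , _ , eq) = cong proj₁ (π⇒π (sym eq))
  ... | no ∉image        = contradiction (a , b , refl) ∉image

theorem12 : ∀ {x : Level} (X : Set x) → Finite X → (_∗_ : Op₂ X) →
    principalRightIdeal (𝓜 X) _∗_ ≐ (λ (_◇_ : Op₂ X) → π _∗_ ⇒ π _◇_)
theorem12 X fin _∗_ =
  (λ {_◇_} → ideal⇒π _∗_ _◇_) , (λ {_◇_} → π⇒ideal fin _∗_ _◇_)
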